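{- For every integer $n>8750$, the number of nice words of length $n$ satisfies $$|\mathcal N_n|>\frac{1.01^n}{7.8}.$$
   Context: Words are over $\{0,1,2\}$. A word $s_1\ldots s_{2m}$ ($m\ge1$) is a square if $s_i=s_{i+m}$ for all $i\le m$; a word is square-free if no factor of it is a square. $\overline w$ is the mirror image of $w$. Let $q=1202120121021201021$, $\overline{q}=1201021201210212021$, $p=\overline{q}\,0\,q$. A word $v$ is nice if $p\,v\,p$ is square-free and contains exactly two occurrences of $q$ and exactly two occurrences of $\overline q$. $\mathcal N_n$ is the set of nice words of length $n$. -}

module Defs where

open import Data.Nat using (ℕ; _<_)
open import Data.Fin using (Fin; #_)
open import Data.List using (List; []; _∷_; _++_; length; reverse)
open import Data.Product using (Σ; ∃; ∃-syntax; _×_)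
open import Data.Sum using (_⊎_)
open import Relation.Binary.PropositionalEquality using (_≡_; _≢_)
open import Relation.Nullary using (¬_)

Letter : Set
Letter = Fin 3

Word : Set
Word = List Letter

mirror : Word → Word
mirror = reverse

IsSquare : Word → Set
IsSquare w = ∃[ u ] (u ≢ [] × w ≡ u ++ u)

Factor : Word → Word → Set
Factor f w = ∃[ x ] ∃[ y ] (w ≡ x ++ f ++ y)

SquareFree : Word → Set
SquareFree w = ∀ f → Factor f w → ¬ IsSquare f

-- an occurrence of u in w, identified by the prefix x preceding it
OccursAfter : Word → Word → Word → Set
OccursAfter u w x = ∃[ y ] (w ≡ x ++ u ++ y)

ExactlyTwoOcc : Word → Word → Set
ExactlyTwoOcc u w =
  ∃[ x₁ ] ∃[ x₂ ] (length x₁ < length x₂ × OccursAfter u w x₁ × OccursAfter u w x₂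
                   × (∀ x → OccursAfter u w x → x ≡ x₁ ⊎ x ≡ x₂))

q : Word
q = # 1 ∷ # 2 ∷ # 0 ∷ # 2 ∷ # 1 ∷ # 2 ∷ # 0 ∷ # 1 ∷ # 2 ∷ # 1 ∷ # 0 ∷ # 2 ∷ # 1 ∷ # 2 ∷ # 0 ∷ # 1 ∷ # 0 ∷ # 2 ∷ # 1 ∷ []

qbar : Word
qbar = mirror q

p : Word
p = qbar ++ (# 0 ∷ []) ++ q

Nice : Word → Set
Nice v = SquareFree (p ++ v ++ p) × ExactlyTwoOcc q (p ++ v ++ p) × ExactlyTwoOcc qbar (p ++ v ++ p)

InN : ℕ → Word → Set
InN n v = Nice v × length v ≡ n

module Submission where

-- Let w be a square-free word. Replace each letter x of w by a block K core(x, c) of length 46, where the bit c is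
-- free and x itself stands at offset 38, and close off with K and with ends a on the left and b on the right:
-- v = a K core(x₁, c₁) … K core(xₖ, cₖ) K b. The words K, core, a, b are such that a factor of length 17 determines
-- its position in p v p, except that it may be shifted from one p to the other, or from one block to another.
-- Hence q and its mirror image occur only in the two copies of p, and the period of a square is at most 16 (a finite
-- check) or a multiple of 46. In the latter case the square lies within the blocks, and its letters at offset 38
-- form a square in w. The k free bits give 2ᵏ nice words, and 1.01⁴⁶ < 2. The ends come in 46 total lengths, one for
-- each residue of n modulo 46.

open import Defs
open import Data.Bool using (Bool; true; false; T; T?)
import Data.Char as Char
open import Data.Fin using (Fin; toℕ; inject≤; remQuot)
import Data.Fin.Properties as Fin
open import Data.Fin.Patterns using (0F; 1F; 2F)
open import Data.List using (List; []; _∷_; _++_; length; map; take; drop; head; foldr; upTo)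
open import Data.List.Properties
  using (≡-dec; ++-assoc; ++-cancelˡ; ∷-injectiveʳ; length-++; length-map; map-∘; map-id; length-take; length-drop;
         take-take; take-drop; drop-drop; take++drop≡id)
open import Data.List.Membership.Propositional.Properties using (∈-map⁻)
open import Data.List.Relation.Unary.All as All using (All; []; _∷_)
import Data.List.Relation.Unary.All.Properties as All
open import Data.List.Relation.Unary.AllPairs using ([]; _∷_)
open import Data.List.Relation.Unary.Unique.Propositional using (Unique)
import Data.List.Relation.Unary.Unique.Propositional.Properties as Unique
open import Data.Maybe using (Maybe; just; nothing)
import Data.Maybe.Properties as Maybe
open import Data.Maybe.Properties using (just-injective)
open import Data.Nat
open import Data.Nat.DivMod using (_divMod_; _mod_; result)
open import Data.Nat.Properties
open import Data.Nat.Tactic.RingSolver using (solve-∀)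
open import Data.Product using (_×_; _,_; proj₁; proj₂; ∃-syntax)
open import Data.String using (String; toList)
open import Data.Sum using (_⊎_; inj₁; inj₂)
import Data.Sum as Sum
import Data.Sum.Properties as Sum
open import Data.Vec using (Vec; []; _∷_; lookup)
open import Function using (_∘_; case_of_)
open import Relation.Binary.PropositionalEquality
open import Relation.Nullary using (Dec; yes; no; contradiction; ¬_; ¬?)
open import Relation.Nullary.Decidable using (isYes; toWitness; map′; _×-dec_; _→-dec_)

-- Prefixes, suffixes and letters at a position.

module _ {A : Set} where

  drop-++ : ∀ (g : List A) i r → drop (length g + i) (g ++ r) ≡ drop i r
  drop-++ []      i r = refl
  drop-++ (x ∷ g) i r = drop-++ g i r

  drop-length-++ : ∀ (g r : List A) → drop (length g) (g ++ r) ≡ r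
  drop-length-++ []      r = refl
  drop-length-++ (x ∷ g) r = drop-length-++ g r

  take-drop-++ : ∀ i d (g r : List A) → i + d ≤ length g → take d (drop i (g ++ r)) ≡ take d (drop i g)
  take-drop-++ zero    zero    g       r _        = refl
  take-drop-++ zero    (suc d) (x ∷ g) r (s≤s le) = cong (x ∷_) (take-drop-++ zero d g r le)
  take-drop-++ (suc i) d       (x ∷ g) r (s≤s le) = take-drop-++ i d g r le

  take-length-++ : ∀ (g r : List A) → take (length g) (g ++ r) ≡ g
  take-length-++ []      r = refl
  take-length-++ (x ∷ g) r = cong (x ∷_) (take-length-++ g r)

  take-take-≤ : ∀ {c d} (v : List A) → c ≤ d → take c (take d v) ≡ take c v
  take-take-≤ v c≤d = trans (take-take _ _ v) (cong (λ n → take n v) (m≤n⇒m⊓n≡m c≤d))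

  take-mono : ∀ {c d} {v v′ : List A} → c ≤ d → take d v ≡ take d v′ → take c v ≡ take c v′
  take-mono {v = v} {v′} c≤d eq = trans (sym (take-take-≤ v c≤d)) (trans (cong (take _) eq) (take-take-≤ v′ c≤d))

  at : List A → ℕ → Maybe A
  at w i = head (drop i w)

  at-take : ∀ {s} (v v′ : List A) → take s v ≡ take s v′ → ∀ {j} → j < s → at v j ≡ at v′ j
  at-take {suc s} []      []        eq   _                   = refl
  at-take {suc s} (x ∷ v) (y ∷ v′) eq   {zero}  _           = cong head eq
  at-take {suc s} (x ∷ v) (y ∷ v′) eq   {suc j} (s≤s j<s)   = at-take v v′ (cong (drop 1) eq) j<s

  take-at : ∀ s (v v′ : List A) → (∀ {j} → j < s → at v j ≡ at v′ j) → take s v ≡ take s v′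
  take-at zero    v       v′        h = refl
  take-at (suc s) []      []        h = refl
  take-at (suc s) []      (y ∷ v′)  h = case h z<s of λ ()
  take-at (suc s) (x ∷ v) []        h = case h z<s of λ ()
  take-at (suc s) (x ∷ v) (y ∷ v′)  h =
    cong₂ _∷_ (just-injective (h z<s)) (take-at s v v′ (λ j<s → h (s≤s j<s)))

  at-++ˡ : ∀ (g r : List A) i {x} → at g i ≡ just x → at (g ++ r) i ≡ just x
  at-++ˡ []      r zero    ()
  at-++ˡ []      r (suc i) ()
  at-++ˡ (y ∷ g) r zero    eq = eq
  at-++ˡ (y ∷ g) r (suc i) eq = at-++ˡ g r i eq

-- Squares given by position and period.

-- Start `i` and period `s` replace the explicit factor, so that the two halves can be compared by
-- arithmetic on positions.
record Square (w : Word) (i s : ℕ) : Set where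
  constructor square
  field
    positive : 0 < s
    fits     : i + (s + s) ≤ length w
    repeats  : take s (drop i w) ≡ take s (drop (i + s) w)

squareFree⇒¬square : ∀ {w} → SquareFree w → ∀ {i s} → ¬ Square w i s
squareFree⇒¬square {w} sf {i} {s} (square 0<s le eq) = sf (u ++ u) (take i w , y , split) (u , u≢[] , refl)
  where
  open ≡-Reasoning
  u = take s (drop i w)
  y = drop s (drop (i + s) w)
  split : w ≡ take i w ++ (u ++ u) ++ y
  split = begin
    w                                                ≡⟨ take++drop≡id i w ⟨
    take i w ++ drop i w                             ≡⟨ cong (take i w ++_) (take++drop≡id s (drop i w)) ⟨
    take i w ++ u ++ drop s (drop i w)               ≡⟨ cong (λ v → take i w ++ u ++ v) (drop-drop i s w) ⟩
    take i w ++ u ++ drop (i + s) w                  ≡⟨ cong (λ v → take i w ++ u ++ v) (take++drop≡id s (drop (i + s) w)) ⟨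
    take i w ++ u ++ take s (drop (i + s) w) ++ y    ≡⟨ cong (λ v → take i w ++ u ++ v ++ y) eq ⟨
    take i w ++ u ++ u ++ y                          ≡⟨ cong (take i w ++_) (++-assoc u u y) ⟨
    take i w ++ (u ++ u) ++ y                        ∎
  i+s≤ : i + s ≤ length w
  i+s≤ = ≤-trans (+-monoʳ-≤ i (m≤m+n s s)) le
  |u| : length u ≡ s
  |u| = begin
    length u                ≡⟨ length-take s (drop i w) ⟩
    s ⊓ length (drop i w)   ≡⟨ cong (s ⊓_) (length-drop i w) ⟩
    s ⊓ (length w ∸ i)      ≡⟨ m≤n⇒m⊓n≡m (m+n≤o⇒m≤o∸n s (subst (_≤ length w) (+-comm i s) i+s≤)) ⟩
    s                       ∎
  u≢[] : u ≢ []
  u≢[] u≡[] = <⇒≢ 0<s (trans (sym (cong length u≡[])) |u|)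

¬square⇒squareFree : ∀ {w} → (∀ {i s} → ¬ Square w i s) → SquareFree w
¬square⇒squareFree ¬sq _ (x , y , refl) ([] , u≢[] , refl) = u≢[] refl
¬square⇒squareFree ¬sq _ (x , y , refl) (u@(_ ∷ _) , _ , refl) = ¬sq (square z<s le eq)
  where
  open ≡-Reasoning
  w = x ++ (u ++ u) ++ y
  le : length x + (length u + length u) ≤ length w
  le = ≤-trans (+-monoʳ-≤ (length x) (≤-trans (≤-reflexive (sym (length-++ u)))
                 (≤-trans (m≤m+n _ (length y)) (≤-reflexive (sym (length-++ (u ++ u)))))))
               (≤-reflexive (sym (length-++ x)))
  drop-x : drop (length x) w ≡ u ++ u ++ y
  drop-x = trans (drop-length-++ x _) (++-assoc u u y)
  eq : take (length u) (drop (length x) w) ≡ take (length u) (drop (length x + length u) w)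
  eq = begin
    take (length u) (drop (length x) w)                   ≡⟨ cong (take (length u)) drop-x ⟩
    take (length u) (u ++ u ++ y)                         ≡⟨ take-length-++ u (u ++ y) ⟩
    u                                                     ≡⟨ take-length-++ u y ⟨
    take (length u) (u ++ y)                              ≡⟨ cong (take (length u)) (drop-length-++ u (u ++ y)) ⟨
    take (length u) (drop (length u) (u ++ u ++ y))       ≡⟨ cong (take (length u) ∘ drop (length u)) drop-x ⟨
    take (length u) (drop (length u) (drop (length x) w)) ≡⟨ cong (take (length u)) (drop-drop (length x) (length u) w) ⟩
    take (length u) (drop (length x + length u) w)        ∎

-- Zones, and operations on square-free words.

-- A zone tells where in p v p a short window may sit, E being the position of the second p: outer i at i or E + i,
-- inner i at offset i in some block K core, tail i at i places after the start of the last K.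
Zone : Set
Zone = ℕ ⊎ ℕ ⊎ ℕ

pattern outer i = inj₁ i
pattern inner i = inj₂ (inj₁ i)
pattern tail i  = inj₂ (inj₂ i)

-- Only squares at the very start of `g` are excluded; applied at every position of a word, this
-- rules out all its squares of period at most `ℓ`.
ShortSquareFree : ℕ → Word → Set
ShortSquareFree ℓ g = ∀ {s} → s < ℓ → suc s + suc s ≤ length g → take (suc s) g ≢ take (suc s) (drop (suc s) g)

shortSquareFree? : ∀ ℓ g → Dec (ShortSquareFree ℓ g)
shortSquareFree? ℓ g = allUpTo? (λ s → _ ≤? _ →-dec ¬? (≡-dec Fin._≟_ _ _)) ℓ

_≟ᶻ_ : (y z : Maybe Zone) → Dec (y ≡ z)
_≟ᶻ_ = Maybe.≡-dec (Sum.≡-dec _≟_ (Sum.≡-dec _≟_ _≟_))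

squareFree-take : ∀ {w} n → SquareFree w → SquareFree (take n w)
squareFree-take {w} n sf f (x , y , eq) = sf f (x , y ++ drop n w , (begin
  w                          ≡⟨ take++drop≡id n w ⟨
  take n w ++ drop n w       ≡⟨ cong (_++ drop n w) eq ⟩
  (x ++ f ++ y) ++ drop n w  ≡⟨ ++-assoc x (f ++ y) _ ⟩
  x ++ (f ++ y) ++ drop n w  ≡⟨ cong (x ++_) (++-assoc f y _) ⟩
  x ++ f ++ y ++ drop n w    ∎))
  where open ≡-Reasoning

squareFree-factor : ∀ {x w y} → SquareFree (x ++ w ++ y) → SquareFree w
squareFree-factor {x} {w} {y} sf f (x′ , y′ , refl) = sf f (x ++ x′ , y′ ++ y , (begin
  x ++ (x′ ++ f ++ y′) ++ y      ≡⟨ cong (x ++_) (++-assoc x′ (f ++ y′) y) ⟩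
  x ++ x′ ++ (f ++ y′) ++ y      ≡⟨ cong (λ v → x ++ x′ ++ v) (++-assoc f y′ y) ⟩
  x ++ x′ ++ f ++ y′ ++ y        ≡⟨ ++-assoc x x′ _ ⟨
  (x ++ x′) ++ f ++ y′ ++ y      ∎))
  where open ≡-Reasoning

Choice : Set
Choice = Letter × Bool

allChoices? : {P : Choice → Set} → (∀ z → Dec (P z)) → Dec (∀ z → P z)
allChoices? P? = map′
  (λ { h (x , false) → proj₁ (h x) ; h (x , true) → proj₂ (h x) })
  (λ h x → h (x , false) , h (x , true))
  (Fin.all? λ x → P? (x , false) ×-dec P? (x , true))

-- Blocks and their finite checks.

-- Blocks have length m and carry the letter they encode at offset t. Squares of period at most ℓ are excluded
-- by inspection of views of length D; longer squares repeat a window of length L.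
module Blocks (ℓ m t : ℕ) (K : Word) (core : Letter → Bool → Word) where

  κ = length K
  L = suc ℓ
  D = ℓ + ℓ

  block : Choice → Word
  block (x , c) = K ++ core x c

  NoShort : Word → Set
  NoShort v = ShortSquareFree ℓ (take D v)

  -- The windows inside the last copy of K also occur at the start of every block, so they are inner.
  zoneʳ : Word → ℕ → Zone
  zoneʳ b i with i + L ≤? κ | i <? κ + length b
  ... | yes _ | _     = inner i
  ... | no  _ | yes _ = tail i
  ... | no  _ | no  _ = outer (i ∸ (κ + length b))

  -- By `D≤1+κ`, a view that starts even at the last letter of a block ends within the `K` that
  -- follows, so it depends on one choice only. By `κ≤t` and `t<m`, the sampled letter lies in the
  -- core.
  record BlocksValid : Set where
    field
      1≤ℓ         : 1 ≤ ℓ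
      D≤1+κ       : D ≤ suc κ
      κ≤t         : κ ≤ t
      t<m         : t < m
      |block|     : ∀ z → length (block z) ≡ m
      block-t     : ∀ z → at (block z) t ≡ just (proj₁ z)
      core-≢      : ∀ x → core x false ≢ core x true
      inner-short : ∀ z {i} → i < m → NoShort (drop i (block z ++ K))

  private
    blockChecks = 1 ≤? ℓ ×-dec D ≤? suc κ ×-dec κ ≤? t ×-dec t <? m
      ×-dec allChoices? (λ z → length (block z) ≟ m)
      ×-dec allChoices? (λ z → Maybe.≡-dec Fin._≟_ (at (block z) t) (just (proj₁ z)))
      ×-dec Fin.all? (λ x → ¬? (≡-dec Fin._≟_ (core x false) (core x true)))
      ×-dec allChoices? (λ z → allUpTo? (λ i → shortSquareFree? ℓ (take D (drop i (block z ++ K)))) m)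

  checkBlocks : Bool
  checkBlocks = isYes blockChecks

  blocksValid : T checkBlocks → BlocksValid
  blocksValid ok with h₁ , h₂ , h₃ , h₄ , h₅ , h₆ , h₇ , h₈ ← toWitness {a? = blockChecks} ok = record
    { 1≤ℓ = h₁ ; D≤1+κ = h₂ ; κ≤t = h₃ ; t<m = h₄ ; |block| = h₅ ; block-t = h₆ ; core-≢ = h₇
    ; inner-short = λ z → h₈ z }

  -- Splicing blocks between two ends.

  module Splice (e a b : Word) (zone : Word → Maybe Zone) where

    -- Since `zone` is a function, the equations below force windows with different zones to be
    -- different words. Every window of the whole word starts in the left part, in a block or in the
    -- right part, so these finitely many cases cover it.
    record EndsValid : Set where
      field
        left-zone   : ∀ {i} → i < length (e ++ a) → zone (take L (drop i ((e ++ a) ++ K))) ≡ just (outer i)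
        left-short  : ∀ {i} → i < length (e ++ a) → NoShort (drop i ((e ++ a) ++ K))
        inner-zone  : ∀ z {i} → i < m → zone (take L (drop i (block z ++ K))) ≡ just (inner i)
        right-zone  : ∀ {i} → i + L ≤ length (K ++ b ++ e) → zone (take L (drop i (K ++ b ++ e))) ≡ just (zoneʳ b i)
        right-short : ∀ {i} → i < length (K ++ b ++ e) → NoShort (drop i (K ++ b ++ e))

    private
      endChecks =
        allUpTo? (λ i → zone (take L (drop i ((e ++ a) ++ K))) ≟ᶻ just (outer i)) (length (e ++ a))
        ×-dec allUpTo? (λ i → shortSquareFree? ℓ (take D (drop i ((e ++ a) ++ K)))) (length (e ++ a))
        ×-dec allChoices? (λ z → allUpTo? (λ i → zone (take L (drop i (block z ++ K))) ≟ᶻ just (inner i)) m)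
        ×-dec allUpTo? (λ i → i + L ≤? length (K ++ b ++ e) →-dec zone (take L (drop i (K ++ b ++ e))) ≟ᶻ just (zoneʳ b i))
                       (length (K ++ b ++ e))
        ×-dec allUpTo? (λ i → shortSquareFree? ℓ (take D (drop i (K ++ b ++ e)))) (length (K ++ b ++ e))

    checkEnds : Bool
    checkEnds = isYes endChecks

    endsValid : T checkEnds → EndsValid
    endsValid ok with h₁ , h₂ , h₃ , h₄ , h₅ ← toWitness {a? = endChecks} ok = record
      { left-zone = h₁ ; left-short = h₂ ; inner-zone = λ z → h₃ z
      ; right-zone = λ {i} le → h₄ (<-≤-trans (m<m+n i z<s) le) le ; right-short = h₅ }

    -- The final segment `s` is a parameter because it is `K ++ b` in the spliced word and
    -- `K ++ b ++ e` in the word to be analysed.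
    thread : Word → List Choice → Word
    thread s []       = s
    thread s (z ∷ zs) = block z ++ thread s zs

    thread-++ : ∀ s r zs → thread s zs ++ r ≡ thread (s ++ r) zs
    thread-++ s r []       = refl
    thread-++ s r (z ∷ zs) = trans (++-assoc (block z) _ r) (cong (block z ++_) (thread-++ s r zs))

    splice : List Choice → Word
    splice zs = a ++ thread (K ++ b) zs

    module _ (blocks : BlocksValid) (ends : EndsValid) where
      open BlocksValid blocks
      open EndsValid ends

      -- Lengths, injectivity and sampling.

      ℓ≤κ : ℓ ≤ κ
      ℓ≤κ = +-cancelˡ-≤ 1 _ _ (≤-trans (+-monoˡ-≤ ℓ 1≤ℓ) D≤1+κ)

      L≤D : L ≤ D
      L≤D = +-monoˡ-≤ ℓ 1≤ℓ

      length-thread : ∀ s zs → length (thread s zs) ≡ length zs * m + length s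
      length-thread s []       = refl
      length-thread s (z ∷ zs) = begin
        length (block z ++ thread s zs)            ≡⟨ length-++ (block z) ⟩
        length (block z) + length (thread s zs)    ≡⟨ cong₂ _+_ (|block| z) (length-thread s zs) ⟩
        m + (length zs * m + length s)             ≡⟨ +-assoc m _ _ ⟨
        m + length zs * m + length s               ∎
        where open ≡-Reasoning

      length-splice : ∀ zs → length (splice zs) ≡ length a + (length zs * m + (κ + length b))
      length-splice zs = begin
        length (splice zs)                                      ≡⟨ length-++ a ⟩
        length a + length (thread (K ++ b) zs)                  ≡⟨ cong (length a +_) (length-thread (K ++ b) zs) ⟩
        length a + (length zs * m + length (K ++ b))            ≡⟨ cong (λ n → length a + (length zs * m + n)) (length-++ K) ⟩
        length a + (length zs * m + (κ + length b))             ∎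
        where open ≡-Reasoning

      -- The letter is read off at offset `t`; once the letters agree, the bit is determined because
      -- the two cores of a letter differ.
      block-injective : ∀ z z′ → block z ≡ block z′ → z ≡ z′
      block-injective (x , c) (x′ , c′) eq
        with refl ← just-injective (trans (sym (block-t (x , c))) (trans (cong (λ v → at v t) eq) (block-t (x′ , c′))))
        with c | c′ | ++-cancelˡ K _ _ eq
      ... | false | false | _   = refl
      ... | false | true  | eq′ = contradiction eq′ (core-≢ x)
      ... | true  | false | eq′ = contradiction (sym eq′) (core-≢ x)
      ... | true  | true  | _   = refl

      thread-≢ : ∀ s z zs → s ≢ thread s (z ∷ zs)
      thread-≢ s z zs eq = <⇒≢ (m<n+m (length s) (<-≤-trans (≤-<-trans z≤n t<m) (m≤m+n m _)))
        (trans (cong length eq) (length-thread s (z ∷ zs)))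

      thread-injective : ∀ s zs zs′ → thread s zs ≡ thread s zs′ → zs ≡ zs′
      thread-injective s []       []         _  = refl
      thread-injective s []       (z ∷ zs)   eq = contradiction eq (thread-≢ s z zs)
      thread-injective s (z ∷ zs) []         eq = contradiction (sym eq) (thread-≢ s z zs)
      thread-injective s (z ∷ zs) (z′ ∷ zs′) eq = cong₂ _∷_ (block-injective z z′ heads) (thread-injective s zs zs′ tails)
        where
        open ≡-Reasoning
        heads : block z ≡ block z′
        heads = begin
          block z                                              ≡⟨ take-length-++ (block z) _ ⟨
          take (length (block z)) (thread s (z ∷ zs))          ≡⟨ cong₂ take (trans (|block| z) (sym (|block| z′))) eq ⟩
          take (length (block z′)) (thread s (z′ ∷ zs′))       ≡⟨ take-length-++ (block z′) _ ⟩
          block z′                                             ∎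
        tails : thread s zs ≡ thread s zs′
        tails = ++-cancelˡ (block z) _ _ (trans eq (cong (_++ thread s zs′) (sym heads)))

      splice-injective : ∀ {zs zs′} → splice zs ≡ splice zs′ → zs ≡ zs′
      splice-injective eq = thread-injective (K ++ b) _ _ (++-cancelˡ a _ _ eq)

      at-thread : ∀ s zs {h} → h < length zs → at (thread s zs) (h * m + t) ≡ at (map proj₁ zs) h
      at-thread s (z ∷ zs) {zero}  _         = at-++ˡ (block z) (thread s zs) t (block-t z)
      at-thread s (z ∷ zs) {suc h} (s≤s h<k) = begin
        at (thread s (z ∷ zs)) (m + h * m + t)                    ≡⟨ cong (at (thread s (z ∷ zs))) (+-assoc m _ t) ⟩
        at (thread s (z ∷ zs)) (m + (h * m + t))                  ≡⟨ cong (λ n → at (thread s (z ∷ zs)) (n + (h * m + t))) (|block| z) ⟨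
        at (thread s (z ∷ zs)) (length (block z) + (h * m + t))   ≡⟨ cong head (drop-++ (block z) (h * m + t) (thread s zs)) ⟩
        at (thread s zs) (h * m + t)                              ≡⟨ at-thread s zs h<k ⟩
        at (map proj₁ zs) h                                       ∎
        where open ≡-Reasoning

      -- Windows from the first block on.

      body : List Choice → Word
      body = thread (K ++ b ++ e)

      -- Both a block and the right end begin with `K`. Hence a view that starts in the preceding
      -- block or in the left end can be computed without knowing what comes after that `K`.
      body-K : ∀ zs → ∃[ r ] body zs ≡ K ++ r
      body-K []             = b ++ e , refl
      body-K ((x , c) ∷ zs) = core x c ++ body zs , ++-assoc K (core x c) (body zs)

      take-block : ∀ z zs {i} → i < m → take D (drop i (block z ++ K)) ≡ take D (drop i (body (z ∷ zs)))
      take-block z zs {i} i<m with r , eq ← body-K zs = begin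
        take D (drop i (block z ++ K))          ≡⟨ take-drop-++ i D (block z ++ K) r i+D≤ ⟨
        take D (drop i ((block z ++ K) ++ r))   ≡⟨ cong (take D ∘ drop i) (++-assoc (block z) K r) ⟩
        take D (drop i (block z ++ K ++ r))     ≡⟨ cong (λ v → take D (drop i (block z ++ v))) eq ⟨
        take D (drop i (body (z ∷ zs)))         ∎
        where
        open ≡-Reasoning
        i+D≤ : i + D ≤ length (block z ++ K)
        i+D≤ = ≤-trans (+-monoʳ-≤ i D≤1+κ) (≤-trans (≤-reflexive (+-suc i κ))
                 (≤-trans (+-monoˡ-≤ κ i<m) (≤-reflexive (sym (trans (length-++ (block z)) (cong (_+ κ) (|block| z)))))))

      take-left : ∀ zs {i} → i < length (e ++ a) → take D (drop i ((e ++ a) ++ K)) ≡ take D (drop i ((e ++ a) ++ body zs))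
      take-left zs {i} i< with r , eq ← body-K zs = begin
        take D (drop i ((e ++ a) ++ K))          ≡⟨ take-drop-++ i D ((e ++ a) ++ K) r i+D≤ ⟨
        take D (drop i (((e ++ a) ++ K) ++ r))   ≡⟨ cong (take D ∘ drop i) (++-assoc (e ++ a) K r) ⟩
        take D (drop i ((e ++ a) ++ K ++ r))     ≡⟨ cong (λ v → take D (drop i ((e ++ a) ++ v))) eq ⟨
        take D (drop i ((e ++ a) ++ body zs))    ∎
        where
        open ≡-Reasoning
        i+D≤ : i + D ≤ length ((e ++ a) ++ K)
        i+D≤ = ≤-trans (+-monoʳ-≤ i D≤1+κ) (≤-trans (≤-reflexive (+-suc i κ))
                 (≤-trans (+-monoˡ-≤ κ i<) (≤-reflexive (sym (length-++ (e ++ a))))))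

      zone-cong : ∀ {v v′ z} → take D v ≡ take D v′ → zone (take L v) ≡ z → zone (take L v′) ≡ z
      zone-cong eq = trans (cong zone (take-mono L≤D (sym eq)))

      noShort-cong : ∀ {v v′} → take D v ≡ take D v′ → NoShort v → NoShort v′
      noShort-cong eq = subst (ShortSquareFree ℓ) eq

      drop-block : ∀ s z zs j → drop (m + j) (thread s (z ∷ zs)) ≡ drop j (thread s zs)
      drop-block s z zs j = trans (cong (λ n → drop (n + j) (thread s (z ∷ zs))) (sym (|block| z))) (drop-++ (block z) j (thread s zs))

      noShort-body : ∀ zs {j} → j < length (body zs) → NoShort (drop j (body zs))
      noShort-body []       j< = right-short j<
      noShort-body (z ∷ zs) {j} j< with j <? m
      ... | yes j<m = noShort-cong {drop j (block z ++ K)} (take-block z zs j<m) (inner-short z j<m)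
      ... | no  j≮m with i , refl ← m≤n⇒∃[o]m+o≡n (≮⇒≥ j≮m) =
        subst NoShort (sym (drop-block _ z zs i)) (noShort-body zs (+-cancelˡ-< m _ _
          (subst (m + i <_) (trans (length-++ (block z)) (cong (_+ length (body zs)) (|block| z))) j<)))

      -- Positions are counted from the start of the first of `k` blocks, so an outer position here
      -- lies in the second copy of `e`. The inequality for inner zones says that the window ends no
      -- later than the last `K`; this is what later keeps long squares away from the right end.
      At : ℕ → Zone → ℕ → Set
      At k (outer i) j = j ≡ k * m + (κ + length b) + i
      At k (inner i) j = i < m × (∃[ h ] j ≡ h * m + i) × j + L ≤ k * m + κ
      At k (tail i)  j = j ≡ k * m + i

      at-suc : ∀ k z {j} → At k z j → At (suc k) z (m + j)
      at-suc k (outer i) refl = trans (sym (+-assoc m (k * m + _) i)) (cong (_+ i) (sym (+-assoc m (k * m) _)))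
      at-suc k (inner i) {j} (i<m , (h , eq) , le) = i<m , (suc h , trans (cong (m +_) eq) (sym (+-assoc m _ i))) ,
        ≤-trans (≤-reflexive (+-assoc m j L)) (≤-trans (+-monoʳ-≤ m le) (≤-reflexive (sym (+-assoc m (k * m) κ))))
      at-suc k (tail i)  refl = sym (+-assoc m _ i)

      zoneʳ-at : ∀ j → At 0 (zoneʳ b j) j
      zoneʳ-at j with j + L ≤? κ | j <? κ + length b
      ... | yes le | _     = ≤-<-trans (≤-trans (≤-trans (m≤m+n j L) le) κ≤t) t<m , (0 , refl) , le
      ... | no  _  | yes _ = refl
      ... | no  _  | no j≮ = sym (m+[n∸m]≡n (≮⇒≥ j≮))

      zone-body : ∀ zs {j} → j + L ≤ length (body zs) →
                  ∃[ z ] zone (take L (drop j (body zs))) ≡ just z × At (length zs) z j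
      zone-body []       {j} le = zoneʳ b j , right-zone le , zoneʳ-at j
      zone-body (z ∷ zs) {j} le with j <? m
      ... | yes j<m = inner j , zone-cong {drop j (block z ++ K)} (take-block z zs j<m) (inner-zone z j<m) , j<m , (0 , refl) , j+L≤
        where
        j+L≤ : j + L ≤ m + length zs * m + κ
        j+L≤ = ≤-trans (≤-reflexive (+-suc j ℓ)) (+-mono-≤ (≤-trans j<m (m≤m+n m _)) ℓ≤κ)
      ... | no  j≮m with i , refl ← m≤n⇒∃[o]m+o≡n (≮⇒≥ j≮m)
        with y , eq , loc ← zone-body zs {i} (+-cancelˡ-≤ m _ _ (≤-trans (≤-reflexive (sym (+-assoc m i L)))
               (≤-trans le (≤-reflexive (trans (length-++ (block z)) (cong (_+ length (body zs)) (|block| z)))))))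
        = y , trans (cong (zone ∘ take L) (drop-block _ z zs i)) eq , at-suc (length zs) y loc

      -- Windows of the whole word.

      module _ (zs : List Choice) where

        k = length zs
        -- The first block starts at `A`, the second copy of `e` at `E`.
        A = length (e ++ a)
        E = A + (k * m + (κ + length b))
        W = (e ++ a) ++ body zs

        W-splice : e ++ splice zs ++ e ≡ W
        W-splice = begin
          e ++ (a ++ thread (K ++ b) zs) ++ e     ≡⟨ cong (e ++_) (++-assoc a _ e) ⟩
          e ++ a ++ thread (K ++ b) zs ++ e       ≡⟨ cong (λ v → e ++ a ++ v) (thread-++ (K ++ b) e zs) ⟩
          e ++ a ++ thread ((K ++ b) ++ e) zs     ≡⟨ cong (λ s → e ++ a ++ thread s zs) (++-assoc K b e) ⟩
          e ++ a ++ body zs                       ≡⟨ ++-assoc e a _ ⟨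
          W                                       ∎
          where open ≡-Reasoning

        length-e-splice : length (e ++ splice zs) ≡ E
        length-e-splice = begin
          length (e ++ splice zs)                                   ≡⟨ length-++ e ⟩
          length e + length (splice zs)                             ≡⟨ cong (length e +_) (length-splice zs) ⟩
          length e + (length a + (k * m + (κ + length b)))          ≡⟨ +-assoc (length e) _ _ ⟨
          length e + length a + (k * m + (κ + length b))            ≡⟨ cong (_+ (k * m + (κ + length b))) (length-++ e) ⟨
          E                                                         ∎
          where open ≡-Reasoning

        |W| : length W ≡ E + length e
        |W| = begin
          length W                                       ≡⟨ cong length W-splice ⟨
          length (e ++ splice zs ++ e)                   ≡⟨ cong length (++-assoc e (splice zs) e) ⟨
          length ((e ++ splice zs) ++ e)                 ≡⟨ length-++ (e ++ splice zs) ⟩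
          length (e ++ splice zs) + length e             ≡⟨ cong (_+ length e) length-e-splice ⟩
          E + length e                                   ∎
          where open ≡-Reasoning

        noShort : ∀ {j} → j < length W → NoShort (drop j W)
        noShort {j} j< with j <? A
        ... | yes j<A = noShort-cong {drop j ((e ++ a) ++ K)} (take-left zs j<A) (left-short j<A)
        ... | no  j≮A with i , refl ← m≤n⇒∃[o]m+o≡n (≮⇒≥ j≮A) =
          subst NoShort (sym (drop-++ (e ++ a) i (body zs)))
            (noShort-body zs (+-cancelˡ-< A _ _ (subst (A + i <_) (length-++ (e ++ a)) j<)))

        Location : Zone → ℕ → Set
        Location (outer i) j = j ≡ i ⊎ j ≡ E + i
        Location (inner i) j = i < m × (∃[ h ] j ≡ A + (h * m + i)) × j + L ≤ A + (k * m + κ)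
        Location (tail i)  j = j ≡ A + (k * m + i)

        at⇒location : ∀ z {j} → At k z j → Location z (A + j)
        at⇒location (outer i) refl = inj₂ (sym (+-assoc A _ i))
        at⇒location (inner i) {j} (i<m , (h , eq) , le) =
          i<m , (h , cong (A +_) eq) , ≤-trans (≤-reflexive (+-assoc A j L)) (+-monoʳ-≤ A le)
        at⇒location (tail i)  refl = refl

        zone-left : ∀ {j} → j < A → zone (take L (drop j W)) ≡ just (outer j)
        zone-left {j} j<A = zone-cong {drop j ((e ++ a) ++ K)} (take-left zs j<A) (left-zone j<A)

        locate : ∀ {j} → j + L ≤ length W → ∃[ z ] zone (take L (drop j W)) ≡ just z × Location z j
        locate {j} le with j <? A
        ... | yes j<A = outer j , zone-left j<A , inj₁ refl
        ... | no  j≮A with i , refl ← m≤n⇒∃[o]m+o≡n (≮⇒≥ j≮A)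
          with z , eq , loc ← zone-body zs {i} (+-cancelˡ-≤ A _ _ (≤-trans (≤-reflexive (sym (+-assoc A i L)))
                 (≤-trans le (≤-reflexive (length-++ (e ++ a))))))
          = z , trans (cong (zone ∘ take L) (drop-++ (e ++ a) i (body zs))) eq , at⇒location z loc

        -- The windows at `j` and `j + s` start at the same offset `i` of two blocks (the last `K`
        -- counting as the start of one), and the second window ends within the last `K` at the
        -- latest.
        Aligned : ℕ → ℕ → Set
        Aligned j s = ∃[ i ] i < m × (∃[ h ] j ≡ A + (h * m + i)) × (∃[ h ] j + s ≡ A + (h * m + i))
                           × j + s + L ≤ A + (k * m + κ)

        -- An outer zone has just two positions, at distance `E`, and a tail zone only one; an inner
        -- zone fixes the offset within a block.
        same-zone : ∀ z {j s} → 0 < s → Location z j → Location z (j + s) → s ≡ E ⊎ Aligned j s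
        same-zone (outer i) {j} {s} 0<s (inj₁ refl) (inj₁ eq) = contradiction (sym eq) (<⇒≢ (m<m+n j 0<s))
        same-zone (outer i) {j} {s} 0<s (inj₁ refl) (inj₂ eq) = inj₁ (+-cancelˡ-≡ j _ _ (trans eq (+-comm E j)))
        same-zone (outer i) {j} {s} 0<s (inj₂ refl) (inj₁ eq) =
          contradiction (sym eq) (<⇒≢ (≤-<-trans (m≤n+m i E) (m<m+n (E + i) 0<s)))
        same-zone (outer i) {j} {s} 0<s (inj₂ eq) (inj₂ eq′) =
          contradiction (trans eq (sym eq′)) (<⇒≢ (m<m+n j 0<s))
        same-zone (inner i) 0<s (i<m , hj , _) (_ , hj′ , le) = inj₂ (i , i<m , hj , hj′ , le)
        same-zone (tail i) {j} 0<s eq eq′ = contradiction (trans eq (sym eq′)) (<⇒≢ (m<m+n j 0<s))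

        -- Equal windows receive the same label from `zone`, and the label is their zone.
        equal-windows : ∀ {j s} → 0 < s → j + s + L ≤ length W →
                        take L (drop j W) ≡ take L (drop (j + s) W) → s ≡ E ⊎ Aligned j s
        equal-windows {j} {s} 0<s le eq
          with z , zj , loc ← locate {j} (≤-trans (+-monoˡ-≤ L (m≤m+n j s)) le)
          with z′ , zj′ , loc′ ← locate {j + s} le
          with refl ← just-injective (trans (sym zj) (trans (cong zone eq) zj′)) = same-zone z 0<s loc loc′

        shift : ∀ j {s} → take s (drop j W) ≡ take s (drop (j + s) W) → ∀ {r} → r < s → at W (j + r) ≡ at W (j + s + r)
        shift j {s} eq {r} r<s = begin
          at W (j + r)             ≡⟨ cong head (drop-drop j r W) ⟨
          at (drop j W) r          ≡⟨ at-take _ _ eq r<s ⟩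
          at (drop (j + s) W) r    ≡⟨ cong head (drop-drop (j + s) r W) ⟩
          at W (j + s + r)         ∎
          where open ≡-Reasoning

        sample : ∀ {h} → h < k → at W (A + (h * m + t)) ≡ at (map proj₁ zs) h
        sample h<k = trans (cong head (drop-++ (e ++ a) _ (body zs))) (at-thread _ zs h<k)

        e<E : length e < E
        e<E = begin-strict
          length e                          ≤⟨ m≤m+n _ (length a) ⟩
          length e + length a               ≡⟨ length-++ e ⟨
          A                                 <⟨ m<m+n A (≤-trans 1≤ℓ (≤-trans ℓ≤κ (m≤m+n κ (length b)))) ⟩
          A + (κ + length b)                ≤⟨ +-monoʳ-≤ A (m≤n+m _ (k * m)) ⟩
          E                                 ∎
          where open ≤-Reasoning

        -- The whole word has length `E + length e`, which is less than `E + E`.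
        ¬period-E : ∀ {j} → ¬ (j + (E + E) ≤ length W)
        ¬period-E {j} le = <⇒≱ e<E (+-cancelˡ-≤ E _ _ (≤-trans (m≤n+m _ j) (≤-trans le (≤-reflexive |W|))))

        -- From aligned squares to squares in the encoded word.

        -- The hypothesis on positions puts the sampled letters of the blocks `g`, ..., `g + d - 1`
        -- into the first half of the square. Translation by the period `d * m` carries them to the
        -- sampled letters `d` blocks further on.
        project : ∀ j g {d} → 0 < d → take (d * m) (drop j W) ≡ take (d * m) (drop (j + d * m) W) →
                  (∀ {r} → r < d → ∃[ x ] x < d * m × A + ((g + r) * m + t) ≡ j + x) →
                  g + (d + d) ≤ k → Square (map proj₁ zs) g d
        project j g {d} 0<d eq pos le = square 0<d (subst (_ ≤_) (sym (length-map proj₁ zs)) le) (take-at d _ _ λ {r} r<d →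
          let x , x<s , eqx = pos r<d
              g+r<k     = <-≤-trans (+-monoʳ-< g r<d) (≤-trans (+-monoʳ-≤ g (m≤m+n d d)) le)
              g+d+r<k   = <-≤-trans (+-monoʳ-< (g + d) r<d) (≤-trans (≤-reflexive (+-assoc g d d)) le)
          in begin
          at (drop g (map proj₁ zs)) r               ≡⟨ cong head (drop-drop g r _) ⟩
          at (map proj₁ zs) (g + r)                  ≡⟨ sample g+r<k ⟨
          at W (A + ((g + r) * m + t))               ≡⟨ cong (at W) eqx ⟩
          at W (j + x)                               ≡⟨ shift j eq x<s ⟩
          at W (j + d * m + x)                       ≡⟨ cong (at W) (swap j (d * m) x) ⟩
          at W (j + x + d * m)                       ≡⟨ cong (λ n → at W (n + d * m)) eqx ⟨
          at W (A + ((g + r) * m + t) + d * m)       ≡⟨ cong (at W) (regroup A g r t d m) ⟩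
          at W (A + ((g + d + r) * m + t))           ≡⟨ sample g+d+r<k ⟩
          at (map proj₁ zs) (g + d + r)              ≡⟨ cong head (drop-drop (g + d) r _) ⟨
          at (drop (g + d) (map proj₁ zs)) r         ∎)
          where
          open ≡-Reasoning
          swap : ∀ j s x → j + s + x ≡ j + x + s
          swap = solve-∀
          regroup : ∀ A g r t d m → A + ((g + r) * m + t) + d * m ≡ A + ((g + d + r) * m + t)
          regroup = solve-∀

        square-fits : ∀ h d i → A + (h * m + i) + (d * m + d * m) ≤ A + (k * m + κ) → (h + (d + d)) * m + i ≤ k * m + κ
        square-fits h d i le = +-cancelˡ-≤ A _ _ (≤-trans (≤-reflexive (regroup A h d i m)) le)
          where
          regroup : ∀ A h d i m → A + ((h + (d + d)) * m + i) ≡ A + (h * m + i) + (d * m + d * m)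
          regroup = solve-∀

        -- The sampled positions inside the square are those of the blocks h, h + 1, … when the square starts at or
        -- before the sampled position of its first block, and of the blocks h + 1, h + 2, … otherwise.
        descend : ∀ h d i → i < m → 0 < d → let j = A + (h * m + i) in
                  j + (d * m + d * m) ≤ A + (k * m + κ) →
                  take (d * m) (drop j W) ≡ take (d * m) (drop (j + d * m) W) →
                  ∃[ g ] Square (map proj₁ zs) g d
        descend h d i i<m 0<d le eq with i ≤? t
        -- Here `u` is `t - i`, the distance from the start of the square to its first sampled
        -- letter.
        ... | yes i≤t with u , refl ← m≤n⇒∃[o]m+o≡n i≤t = h , project (A + (h * m + i)) h 0<d eq
                (λ {r} r<d → r * m + u , r*m+u< r<d , regroup A h r i u m) (s≤s⁻¹ (*-cancelʳ-< m _ _ h+2d<))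
          where
          regroup : ∀ A h r i u m → A + ((h + r) * m + (i + u)) ≡ A + (h * m + i) + (r * m + u)
          regroup = solve-∀
          r*m+u< : ∀ {r} → r < d → r * m + u < d * m
          r*m+u< {r} r<d = <-≤-trans (+-monoʳ-< (r * m) (≤-<-trans (m≤n+m u i) t<m))
                             (≤-trans (≤-reflexive (+-comm (r * m) m)) (*-monoˡ-≤ m r<d))
          -- Since `κ < m`, a square that ends within the last `K` spans no further full block,
          -- whence `h + 2d ≤ k`.
          h+2d< : (h + (d + d)) * m < suc k * m
          h+2d< = begin-strict
            (h + (d + d)) * m        ≤⟨ m≤m+n _ i ⟩
            (h + (d + d)) * m + i    ≤⟨ square-fits h d i le ⟩
            k * m + κ                <⟨ +-monoʳ-< (k * m) (≤-<-trans κ≤t t<m) ⟩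
            k * m + m                ≡⟨ +-comm (k * m) m ⟩
            suc k * m                ∎
            where open ≤-Reasoning
        -- Here `y` is `m - i`, the distance from the start of the square to the next block.
        ... | no  i≰t with y , eqm ← m≤n⇒∃[o]m+o≡n (<⇒≤ i<m) = suc h , project (A + (h * m + i)) (suc h) 0<d eq
                (λ {r} r<d → y + r * m + t , y+r*m+t< r<d ,
                   trans (regroup A h r t m) (trans (cong (λ n → A + (h * m + n) + (r * m + t)) (sym eqm)) (regroup′ A (h * m) r t m i y)))
                (*-cancelʳ-< m _ _ (+-cancelʳ-< κ _ _ h+2d<))
          where
          regroup : ∀ A h r t m → A + ((suc h + r) * m + t) ≡ A + (h * m + m) + (r * m + t)
          regroup = solve-∀
          regroup′ : ∀ A x r t m i y → A + (x + (i + y)) + (r * m + t) ≡ A + (x + i) + (y + r * m + t)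
          regroup′ = solve-∀
          commute : ∀ y n t → y + n + t ≡ t + y + n
          commute = solve-∀
          y+r*m+t< : ∀ {r} → r < d → y + r * m + t < d * m
          y+r*m+t< {r} r<d = begin-strict
            y + r * m + t     ≡⟨ commute y (r * m) t ⟩
            t + y + r * m     <⟨ +-monoˡ-< (r * m) (+-monoˡ-< y (≰⇒> i≰t)) ⟩
            i + y + r * m     ≡⟨ cong (_+ r * m) eqm ⟩
            suc r * m         ≤⟨ *-monoˡ-≤ m r<d ⟩
            d * m             ∎
            where open ≤-Reasoning
          -- Starting at block `h + 1` requires the stronger `h + 2d < k`; it holds because
          -- `κ ≤ t < i`.
          h+2d< : (h + (d + d)) * m + κ < k * m + κ
          h+2d< = begin-strict
            (h + (d + d)) * m + κ    <⟨ +-monoʳ-< _ (≤-<-trans κ≤t (≰⇒> i≰t)) ⟩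
            (h + (d + d)) * m + i    ≤⟨ square-fits h d i le ⟩
            k * m + κ                ∎
            where open ≤-Reasoning

        -- Exclusion of short and long squares.

        -- The square has length at most `D`, so it is a prefix of the view at its start.
        ¬square-short : ∀ {j s} → s ≤ ℓ → ¬ Square W j s
        ¬square-short {j} {suc s} s<ℓ (square _ le eq) = noShort (<-≤-trans (m<m+n j z<s) le) s<ℓ length-view (begin
          take (suc s) (take D v)                   ≡⟨ take-take-≤ v (≤-trans s<ℓ (m≤m+n ℓ ℓ)) ⟩
          take (suc s) v                            ≡⟨ eq ⟩
          take (suc s) (drop (j + suc s) W)         ≡⟨ cong (take (suc s)) (drop-drop j (suc s) W) ⟨
          take (suc s) (drop (suc s) v)             ≡⟨ take-drop (suc s) (suc s) v ⟩
          drop (suc s) (take (suc s + suc s) v)     ≡⟨ cong (drop (suc s)) (take-take-≤ v 2s≤D) ⟨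
          drop (suc s) (take (suc s + suc s) (take D v)) ≡⟨ take-drop (suc s) (suc s) (take D v) ⟨
          take (suc s) (drop (suc s) (take D v))    ∎)
          where
          open ≡-Reasoning
          v = drop j W
          2s≤D : suc s + suc s ≤ D
          2s≤D = +-mono-≤ s<ℓ s<ℓ
          length-view : suc s + suc s ≤ length (take D v)
          length-view = subst (suc s + suc s ≤_) (sym (trans (length-take D v) (cong (D ⊓_) (length-drop j W))))
            (⊓-glb 2s≤D (m+n≤o⇒m≤o∸n _ (subst (_≤ length W) (+-comm j _) le)))

        -- The last window of the first half and its translate: an aligned square cannot run into the right end.
        square-end : ∀ {j s} → L ≤ s → Square W j s → s ≡ E ⊎ j + (s + s) ≤ A + (k * m + κ)
        -- With `o = s - L`, the last window of the first half starts at `j + o`, and its translate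
        -- ends exactly where the square ends.
        square-end {j} {s} L≤s (square 0<s le eq) with o , L+o≡s ← m≤n⇒∃[o]m+o≡n L≤s =
          Sum.map₂ (λ (_ , _ , _ , _ , end) → ≤-trans (≤-reflexive (sym (reach L+o≡s))) end)
            (equal-windows {j + o} {s} 0<s (≤-trans (≤-reflexive (reach L+o≡s)) le) (take-at L _ _ λ {r} r<L → begin
               at (drop (j + o) W) r        ≡⟨ cong head (drop-drop (j + o) r W) ⟩
               at W (j + o + r)             ≡⟨ cong (at W) (+-assoc j o r) ⟩
               at W (j + (o + r))           ≡⟨ shift j eq (subst (o + r <_) (trans (+-comm o L) L+o≡s) (+-monoʳ-< o r<L)) ⟩
               at W (j + s + (o + r))       ≡⟨ cong (at W) (swap j s o r) ⟩
               at W (j + o + s + r)         ≡⟨ cong head (drop-drop (j + o + s) r W) ⟨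
               at (drop (j + o + s) W) r    ∎))
          where
          open ≡-Reasoning
          swap : ∀ j s o r → j + s + (o + r) ≡ j + o + s + r
          swap = solve-∀
          regroup : ∀ j o s L → j + o + s + L ≡ j + (s + (L + o))
          regroup = solve-∀
          reach : ∀ {o} → L + o ≡ s → j + o + s + L ≡ j + (s + s)
          reach {o} L+o≡s = trans (regroup j o s L) (cong (λ n → j + (s + n)) L+o≡s)

        aligned-period : ∀ {h h′ i s} → 0 < s → A + (h * m + i) + s ≡ A + (h′ * m + i) → ∃[ d ] 0 < d × s ≡ d * m
        aligned-period {h} {h′} {i} {s} 0<s eq = conclude (m≤n⇒∃[o]m+o≡n h<h′)
          where
          h<h′ : h < h′
          h<h′ = *-cancelʳ-< m h h′ (+-cancelʳ-< i _ _ (+-cancelˡ-< A _ _ (subst (A + (h * m + i) <_) eq (m<m+n _ 0<s))))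
          regroup : ∀ A h d i m → A + ((suc h + d) * m + i) ≡ A + (h * m + i) + suc d * m
          regroup = solve-∀
          conclude : (∃[ d ] suc h + d ≡ h′) → ∃[ d ] 0 < d × s ≡ d * m
          conclude (d , refl) = suc d , z<s , +-cancelˡ-≡ (A + (h * m + i)) _ _ (trans eq (regroup A h d i m))

        -- The first windows of the two halves coincide. Either the period is `E`, which is too
        -- long, or they are aligned and the period is a multiple of `m`; then `square-end` bounds
        -- the square on the right and `descend` finds a square in the encoded word.
        ¬square-long : SquareFree (map proj₁ zs) → ∀ {j s} → L ≤ s → ¬ Square W j s
        ¬square-long sf {j} {s} L≤s sq@(square 0<s le eq)
          with square-end L≤s sq
             | equal-windows {j} 0<s (≤-trans (≤-trans (+-monoʳ-≤ (j + s) L≤s) (≤-reflexive (+-assoc j s s))) le) (take-mono L≤s eq)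
        ... | inj₁ refl | _         = ¬period-E {j} le
        ... | inj₂ _    | inj₁ refl = ¬period-E {j} le
        ... | inj₂ end  | inj₂ (i , i<m , (h , refl) , (h′ , eqs) , _)
          with d , 0<d , refl ← aligned-period {h} {h′} {i} 0<s eqs
          = squareFree⇒¬square sf (proj₂ (descend h d i i<m 0<d end eq))

        splice-squareFree : SquareFree (map proj₁ zs) → SquareFree (e ++ splice zs ++ e)
        splice-squareFree sf = subst SquareFree (sym W-splice) (¬square⇒squareFree λ {j} {s} → case s ≤? ℓ of λ where
          (yes s≤ℓ) → ¬square-short s≤ℓ
          (no  s≰ℓ) → ¬square-long sf (≰⇒> s≰ℓ))

        -- Occurrences of factors of `e`.

        -- The first window of the occurrence in the first `e` has an outer zone. Any other
        -- occurrence of `u` starts with the same window, hence sits at the same place in one of the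
        -- two copies of `e`.
        splice-twoOcc : ∀ {u} x y → e ≡ x ++ u ++ y → L ≤ length u → ExactlyTwoOcc u (e ++ splice zs ++ e)
        splice-twoOcc {u} x y e≡ L≤u = x , e ++ v ++ x , x<x₂ , (y ++ v ++ e , occ₁) , (y , occ₂) , only
          where
          open ≡-Reasoning
          v = splice zs
          occ₁ : e ++ v ++ e ≡ x ++ u ++ y ++ v ++ e
          occ₁ = begin
            e ++ v ++ e                ≡⟨ cong (_++ v ++ e) e≡ ⟩
            (x ++ u ++ y) ++ v ++ e    ≡⟨ ++-assoc x (u ++ y) _ ⟩
            x ++ (u ++ y) ++ v ++ e    ≡⟨ cong (x ++_) (++-assoc u y _) ⟩
            x ++ u ++ y ++ v ++ e      ∎
          occ₂ : e ++ v ++ e ≡ (e ++ v ++ x) ++ u ++ y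
          occ₂ = begin
            e ++ v ++ e                ≡⟨ cong (λ f → e ++ v ++ f) e≡ ⟩
            e ++ v ++ x ++ u ++ y      ≡⟨ cong (e ++_) (++-assoc v x (u ++ y)) ⟨
            e ++ (v ++ x) ++ u ++ y    ≡⟨ ++-assoc e (v ++ x) (u ++ y) ⟨
            (e ++ v ++ x) ++ u ++ y    ∎
          |x₂| : length (e ++ v ++ x) ≡ E + length x
          |x₂| = begin
            length (e ++ v ++ x)          ≡⟨ cong length (++-assoc e v x) ⟨
            length ((e ++ v) ++ x)        ≡⟨ length-++ (e ++ v) ⟩
            length (e ++ v) + length x    ≡⟨ cong (_+ length x) length-e-splice ⟩
            E + length x                  ∎
          x<x₂ : length x < length (e ++ v ++ x)
          x<x₂ = subst (length x <_) (sym |x₂|) (m<n+m (length x) (≤-<-trans z≤n e<E))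
          x+u≤e : length x + length u ≤ length e
          x+u≤e = ≤-trans (+-monoʳ-≤ (length x) (m≤m+n (length u) (length y)))
            (≤-reflexive (sym (trans (cong length e≡) (trans (length-++ x) (cong (length x +_) (length-++ u))))))
          x<A : length x < A
          x<A = <-≤-trans (m<m+n (length x) (≤-trans z<s L≤u)) (≤-trans x+u≤e (≤-trans (m≤m+n _ _) (≤-reflexive (sym (length-++ e)))))
          window : ∀ x′ {y′} → e ++ v ++ e ≡ x′ ++ u ++ y′ → take L (drop (length x′) W) ≡ take L u
          window x′ {y′} eq = begin
            take L (drop (length x′) W)                  ≡⟨ cong (take L ∘ drop (length x′)) (trans (sym W-splice) eq) ⟩
            take L (drop (length x′) (x′ ++ u ++ y′))    ≡⟨ cong (take L) (drop-length-++ x′ _) ⟩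
            take L (u ++ y′)                             ≡⟨ take-drop-++ 0 L u y′ L≤u ⟩
            take L u                                     ∎
          prefix : ∀ {x′ y′ x″ y″} → e ++ v ++ e ≡ x′ ++ y′ → e ++ v ++ e ≡ x″ ++ y″ → length x′ ≡ length x″ → x′ ≡ x″
          prefix {x′} {y′} {x″} {y″} eq′ eq″ leq = begin
            x′                              ≡⟨ take-length-++ x′ y′ ⟨
            take (length x′) (x′ ++ y′)     ≡⟨ cong₂ take leq (trans (sym eq′) eq″) ⟩
            take (length x″) (x″ ++ y″)     ≡⟨ take-length-++ x″ y″ ⟩
            x″                              ∎
          only : ∀ x′ → OccursAfter u (e ++ v ++ e) x′ → x′ ≡ x ⊎ x′ ≡ e ++ v ++ x
          only x′ (y′ , occ)
            with z , eq , loc ← locate {length x′} (≤-trans (+-monoʳ-≤ (length x′) L≤u)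
                   (≤-trans (+-monoʳ-≤ (length x′) (≤-trans (m≤m+n _ (length y′)) (≤-reflexive (sym (length-++ u)))))
                     (≤-reflexive (trans (sym (length-++ x′)) (cong length (trans (sym occ) W-splice))))))
            with refl ← just-injective (trans (sym (zone-left x<A)) (trans (cong zone (trans (window x occ₁) (sym (window x′ occ)))) eq))
            with loc
          ... | inj₁ |x′|≡ = inj₁ (prefix occ occ₁ |x′|≡)
          ... | inj₂ |x′|≡ = inj₂ (prefix occ occ₂ (trans |x′|≡ (sym |x₂|)))

-- Counting the choices of bits.

choices : Word → List (List Choice)
choices []      = [] ∷ []
choices (x ∷ w) = map ((x , false) ∷_) (choices w) ++ map ((x , true) ∷_) (choices w)

choices-over : ∀ w → All (λ zs → map proj₁ zs ≡ w) (choices w)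
choices-over []      = refl ∷ []
choices-over (x ∷ w) = All.++⁺ (All.map⁺ (All.map (cong (x ∷_)) (choices-over w)))
                               (All.map⁺ (All.map (cong (x ∷_)) (choices-over w)))

choices-unique : ∀ w → Unique (choices w)
choices-unique []      = [] ∷ []
choices-unique (x ∷ w) = Unique.++⁺ (Unique.map⁺ ∷-injectiveʳ (choices-unique w)) (Unique.map⁺ ∷-injectiveʳ (choices-unique w))
  λ (∈false , ∈true) → case ∈-map⁻ _ ∈false of λ where
    (_ , _ , refl) → case ∈-map⁻ _ ∈true of λ where (_ , _ , ())

length-choices : ∀ w → length (choices w) ≡ 2 ^ length w
length-choices []      = refl
length-choices (x ∷ w) = begin
  length (choices (x ∷ w))                                    ≡⟨ length-++ (map _ (choices w)) ⟩
  length (map _ (choices w)) + length (map _ (choices w))     ≡⟨ cong₂ _+_ (length-map _ (choices w)) (length-map _ (choices w)) ⟩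
  length (choices w) + length (choices w)                     ≡⟨ cong₂ _+_ (length-choices w) (length-choices w) ⟩
  2 ^ length w + 2 ^ length w                                 ≡⟨ cong (2 ^ length w +_) (+-identityʳ (2 ^ length w)) ⟨
  2 ^ length (x ∷ w)                                          ∎
  where open ≡-Reasoning

-- Labelling windows by tries.

-- Nothing has to be proved about tries: any function labelling the windows as EndsValid demands will do.
data Trie : Set where
  none : Trie
  leaf : Zone → Trie
  node : (t₀ t₁ t₂ : Trie) → Trie

child : Letter → Trie → Trie
child 0F (node t _ _) = t
child 1F (node _ t _) = t
child 2F (node _ _ t) = t
child _  _            = none

graft : Letter → Trie → Trie → Trie
graft 0F t s = node t (child 1F s) (child 2F s)
graft 1F t s = node (child 0F s) t (child 2F s)
graft 2F t s = node (child 0F s) (child 1F s) t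

insert : Word → Zone → Trie → Trie
insert []      z _ = leaf z
insert (x ∷ w) z t = graft x (insert w z (child x t)) t

find : Trie → Word → Maybe Zone
find (leaf z) _       = just z
find _        []      = nothing
find t        (x ∷ w) = find (child x t) w

-- The concrete words and their verification.

-- The code of the digit 0 is 48, a multiple of 3.
word : String → Word
word s = map (λ c → Char.toℕ c mod 3) (toList s)

-- K, core, lefts and rights were found by computer search.
K : Word
K = word "1201020120210121020102120210201"

core : Letter → Bool → Word
core 0F false = word "210120102101202"
core 0F true  = word "210120102012102"
core 1F false = word "210212012101202"
core 1F true  = word "210120210201202"
core 2F false = word "202120121020102"
core 2F true  = word "210212021012102"

lefts : Vec Word 12
lefts =
  word "0121020120212010210" ∷
  word "01210212021020120210" ∷
  word "012102120121020120210" ∷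
  word "0121020121012021201210" ∷
  word "01210201210120212010210" ∷
  word "012102012021020102120210" ∷
  word "0121020120210121021201210" ∷
  word "01210212012102012021201210" ∷
  word "012102120121020120212010210" ∷
  word "0121020121012021012102120210" ∷
  word "01210201210120210121021201210" ∷
  word "012102120210120102012021201210" ∷ []

rights : Vec Word 4
rights =
  word "02101210212010210" ∷
  word "02101202102010212012102010210" ∷
  word "02101202102010212012101201021012102010210" ∷
  word "02101201021202101210201021012021020102101210212010210" ∷ []

-- The lengths 19 + i of the left ends and 17 + 12 j of the right ends add up to 36 + r with r = 12 j + i.
left right : Fin 46 → Word
left r  = lookup lefts (proj₂ (remQuot {4} 12 (inject≤ r (m≤m+n 46 2))))
right r = lookup rights (proj₁ (remQuot {4} 12 (inject≤ r (m≤m+n 46 2))))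

-- `K` has length 31 and views have length 32, so `D≤1+κ` holds with equality.
open Blocks 16 46 38 K core

module S (zone : Word → Maybe Zone) (r : Fin 46) = Splice p (left r) (right r) zone

mark : (ℕ → Zone) → ℕ → Word → Trie → Trie
mark z n w t = foldr (λ i → insert (take 17 (drop i w)) (z i)) t (upTo n)

labelling : Fin 46 → Trie
labelling r =
  mark outer (length (p ++ left r)) (p ++ left r ++ K)
  -- A word of length N has N - 16 windows of length 17.
  (mark (zoneʳ (right r)) (length (K ++ right r ++ p) ∸ 16) (K ++ right r ++ p)
  (foldr (λ x t → foldr (λ c → mark inner 46 (K ++ core x c ++ K)) t (false ∷ true ∷ [])) none (0F ∷ 1F ∷ 2F ∷ [])))

blocks-valid : BlocksValid
blocks-valid = blocksValid _

-- The labelling is an argument, so that it is evaluated only once per r.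
check : Trie → Fin 46 → Bool
check t r = S.checkEnds (find t) r

checked : ∀ r → T (check (labelling r) r)
checked = toWitness {a? = Fin.all? λ r → T? (check (labelling r) r)} _

spliced : Fin 46 → List Choice → Word
spliced r = S.splice (find (labelling r)) r

ends-valid : ∀ r → S.EndsValid (find (labelling r)) r
ends-valid r = S.endsValid (find (labelling r)) r (checked r)

-- Spliced words are nice and distinct.

spliced-squareFree : ∀ r zs → SquareFree (map proj₁ zs) → SquareFree (p ++ spliced r zs ++ p)
spliced-squareFree r = S.splice-squareFree _ r blocks-valid (ends-valid r)

spliced-nice : ∀ r zs → SquareFree (map proj₁ zs) → Nice (spliced r zs)
spliced-nice r zs sf = spliced-squareFree r zs sf
  -- `q` is a suffix of `p` and `qbar` a prefix; both have length 19 = 17 + 2, enough to contain a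
  -- window.
  , S.splice-twoOcc _ r blocks-valid (ends-valid r) zs (qbar ++ 0F ∷ []) [] refl (m≤m+n 17 2)
  , S.splice-twoOcc _ r blocks-valid (ends-valid r) zs [] (0F ∷ q) refl (m≤m+n 17 2)

spliced-injective : ∀ r {zs zs′} → spliced r zs ≡ spliced r zs′ → zs ≡ zs′
spliced-injective r = S.splice-injective _ r blocks-valid (ends-valid r)

length-ends : ∀ r → length (left r) + length (right r) ≡ 36 + toℕ r
length-ends = toWitness {a? = Fin.all? λ r → length (left r) + length (right r) ≟ 36 + toℕ r} _

-- The constant 67 is 31 for the last `K` plus 36 for the shortest pair of ends.
length-spliced : ∀ r zs → length (spliced r zs) ≡ 67 + (toℕ r + length zs * 46)
length-spliced r zs = begin
  length (spliced r zs)                                              ≡⟨ S.length-splice _ r blocks-valid (ends-valid r) zs ⟩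
  length (left r) + (length zs * 46 + (31 + length (right r)))       ≡⟨ regroup (length (left r)) (length zs * 46) _ ⟩
  31 + (length (left r) + length (right r) + length zs * 46)         ≡⟨ cong (λ n → 31 + (n + length zs * 46)) {y = 36 + toℕ r} (length-ends r) ⟩
  67 + (toℕ r + length zs * 46)                                      ∎
  where
  open ≡-Reasoning
  regroup : ∀ a k b → a + (k + (31 + b)) ≡ 31 + (a + b + k)
  regroup = solve-∀

-- Square-free words of every length.

-- A square-free word of length k is spliced into a longer square-free word, which is then truncated.
squareFree-words : ∀ k → ∃[ w ] length w ≡ k × SquareFree w
squareFree-words zero    = [] , refl , λ { _ (x , y , eq) (u , u≢[] , refl) → u≢[] (empty x u y eq) }
  where
  empty : ∀ x (u : Word) y → [] ≡ x ++ (u ++ u) ++ y → u ≡ []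
  empty [] [] y _ = refl
squareFree-words (suc k) with w , |w| , sf ← squareFree-words k =
  take (suc k) v , trans (length-take (suc k) v) (m≤n⇒m⊓n≡m k<v) ,
  squareFree-take (suc k) (squareFree-factor {p} {v} {p} (spliced-squareFree 0F zs zs-sf))
  where
  open ≤-Reasoning
  zs = map (_, false) w
  v  = spliced 0F zs
  zs-sf : SquareFree (map proj₁ zs)
  zs-sf = subst SquareFree (sym (trans (sym (map-∘ w)) (map-id w))) sf
  k<v : suc k ≤ length v
  k<v = begin
    suc k                            ≡⟨ cong suc (trans (length-map _ w) |w|) ⟨
    suc (length zs)                  ≤⟨ +-mono-≤ (m≤m+n 1 66) (m≤m*n (length zs) 46) ⟩
    67 + length zs * 46              ≡⟨ length-spliced 0F zs ⟨
    length v                         ∎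

-- The growth estimate.

-- This is l > (c/d)(x/y)^n with denominators cleared; x/y = 1.01 and c/d = 1/7.8 give the bound of
-- the theorem.
Exceeds : (x y c d n l : ℕ) → Set
Exceeds x y c d n l = c * x ^ n < d * y ^ n * l

-- Each increase of the exponent by `M` multiplies (x/y)^n by at most 2, while the count doubles.
exceeds-+ : ∀ {x y c d} B M k .{{_ : NonZero x}} → Exceeds x y c d B 1 → x ^ M ≤ y ^ M * 2 →
            Exceeds x y c d (B + k * M) (2 ^ k)
exceeds-+ {x} {y} {c} {d} B M zero    base step = subst (λ n → Exceeds x y c d n 1) (sym (+-identityʳ B)) base
exceeds-+ {x} {y} {c} {d} B M (suc k) base step = begin-strict
  c * x ^ (B + (M + k * M))                       ≡⟨ split x c ⟩
  c * x ^ (B + k * M) * x ^ M                     <⟨ *-monoˡ-< (x ^ M) {{m^n≢0 x M}} (exceeds-+ {x} {y} {c} {d} B M k base step) ⟩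
  d * y ^ (B + k * M) * 2 ^ k * x ^ M             ≤⟨ *-monoʳ-≤ (d * y ^ (B + k * M) * 2 ^ k) step ⟩
  d * y ^ (B + k * M) * 2 ^ k * (y ^ M * 2)       ≡⟨ regroup (d * y ^ (B + k * M)) (2 ^ k) (y ^ M) ⟩
  d * y ^ (B + k * M) * y ^ M * (2 * 2 ^ k)       ≡⟨ cong (_* 2 ^ suc k) (split y d) ⟨
  d * y ^ (B + (M + k * M)) * 2 ^ suc k           ∎
  where
  open ≤-Reasoning
  regroup : ∀ u v w → u * v * (w * 2) ≡ u * w * (2 * v)
  regroup = solve-∀
  rotate : ∀ B M N → B + (M + N) ≡ B + N + M
  rotate = solve-∀
  split : ∀ z c → c * z ^ (B + (M + k * M)) ≡ c * z ^ (B + k * M) * z ^ M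
  split z c = trans (cong (λ n → c * z ^ n) (rotate B M (k * M)))
                (trans (cong (c *_) (^-distribˡ-+-* z (B + k * M) M)) (sym (*-assoc c _ _)))

exceeds? : ∀ x y c d n l → Dec (Exceeds x y c d n l)
exceeds? x y c d n l = c * x ^ n <? d * y ^ n * l

-- Without blocks there is one word, and one is enough: 1.01^(67 + r) is at most 1.01^112, which is
-- below 7.8.
exceeds-67+r : ∀ (r : Fin 46) → Exceeds 101 100 10 78 (67 + toℕ r) 1
exceeds-67+r = toWitness {a? = Fin.all? λ r → exceeds? 101 100 10 78 (67 + toℕ r) 1} _

exceeds-+46k : ∀ (r : Fin 46) k → Exceeds 101 100 10 78 (67 + (toℕ r + k * 46)) (2 ^ k)
exceeds-+46k r k = subst (λ n → Exceeds 101 100 10 78 n (2 ^ k)) (+-assoc 67 (toℕ r) (k * 46))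
  (exceeds-+ {101} {100} {10} {78} (67 + toℕ r) 46 k (exceeds-67+r r) (toWitness {a? = 101 ^ 46 ≤? 100 ^ 46 * 2} _))

-- Many nice words of each length.

distinct-nice : ∀ {n} (f : List Choice → Word) (w : Word) → (∀ {zs zs′} → f zs ≡ f zs′ → zs ≡ zs′) →
                (∀ zs → map proj₁ zs ≡ w → InN n (f zs)) →
                ∃[ vs ] (Unique vs × All (InN n) vs × length vs ≡ 2 ^ length w)
distinct-nice f w f-injective f-nice = map f (choices w) , Unique.map⁺ f-injective (choices-unique w)
  , All.map⁺ (All.map (f-nice _) (choices-over w)) , trans (length-map f (choices w)) (length-choices w)

spliced-InN : ∀ r w zs → SquareFree w → map proj₁ zs ≡ w → InN (67 + (toℕ r + length w * 46)) (spliced r zs)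
spliced-InN r _ zs sf refl = spliced-nice r zs sf , trans (length-spliced r zs)
  (cong (λ n → 67 + (toℕ r + n * 46)) (sym (length-map proj₁ zs)))

ManyNice : ℕ → Set
ManyNice n = ∃[ vs ] (Unique vs × All (InN n) vs × Exceeds 101 100 10 78 n (length vs))

many-nice : ∀ r k → ManyNice (67 + (toℕ r + k * 46))
many-nice r k =
  let w , |w| , sf = squareFree-words k
      vs , unique , nice , |vs| = distinct-nice (spliced r) w (spliced-injective r) (λ zs → spliced-InN r w zs sf)
  in subst (λ k → ManyNice (67 + (toℕ r + k * 46))) |w|
       (vs , unique , nice , subst (Exceeds 101 100 10 78 (67 + (toℕ r + length w * 46))) (sym |vs|) (exceeds-+46k r (length w)))

residue : ∀ {n} b m .{{_ : NonZero m}} → b ≤ n → ∃[ r ] ∃[ k ] b + (toℕ {m} r + k * m) ≡ n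
residue b m b≤n =
  let o , b+o≡n      = m≤n⇒∃[o]m+o≡n b≤n
      result k r o≡  = o divMod m
  in r , k , trans (cong (b +_) (sym o≡)) b+o≡n

theorem4 : (n : ℕ) → 8750 < n →
    ∃[ vs ] (Unique vs × All (InN n) vs × 10 * 101 ^ n < 78 * 100 ^ n * length vs)
theorem4 n 8750<n =
  -- The hypothesis reads 8751 ≤ n, and 67 + 8684 = 8751.
  let r , k , eq = residue 67 46 (≤-trans (m≤m+n 67 8684) 8750<n) in subst ManyNice eq (many-nice r k)
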